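{- Let $A$ be a finite set of colours, let $F=\sum_{t\in T_A'}t$ be the characteristic series of the set $T_A'$ of planted rooted ordered $A$-coloured trees, and let $F^*=\sum_{t\in T_A}t$ be the characteristic series of the set $T_A$ of all rooted ordered $A$-coloured trees. Then $F$ and $F^*$ are elements of the restricted dual $(\Bbbk T_A,\,.\,,\Delta)^\circ$ of the Hopf algebra of rooted ordered coloured trees. In particular, $F$ is a primitive element, $$\delta(F)=\bullet\otimes F+F\otimes\bullet,$$ and $F^*$ is group-like, $$\delta(F^*)=F^*\otimes F^* .$$
   Context: $\Bbbk$ is a field of characteristic zero. A rooted ordered tree is a finite rooted tree in which the children of every vertex are totally ordered. A rooted ordered coloured (ROC) tree over a finite set $A$ is a rooted ordered tree with a function from its set of edges to $A$. $T_A$ is the set of ROC trees and $\Bbbk T_A$ is the $\Bbbk$-vector space with basis $T_A$. The trivial tree $\bullet$ has only a root; a planted tree is a non-trivial tree whose root has exactly one child. Product: $t\,.\,s$ is obtained by identifying the roots of $t$ and $s$, placing the branches of $t$ to the left of those of $s$; the unit is $\bullet$. Pruning coproduct: $\Delta(t)=\sum t_c\otimes t_s$ over all subtrees $t_s$ of $t$ containing the root (including $\bullet$ and $t$), where $t_c$ is the concatenation of the planted branches of $t$ pruned to obtain $t_s$, in the order inherited from $t$ (left-to-right depth-first order). The counit is $\epsilon(\bullet)=1$ and $\epsilon(t)=0$ for $t\neq\bullet$. With these operations $\Bbbk T_A$ is a graded connected Hopf algebra. A formal tree series is a linear functional $G\in(\Bbbk T_A)^*$, written $G=\sum_{t\in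 T_A}\langle G,t\rangle t$; a tree $t$ is identified with the functional dual to it. The deconcatenation coproduct of a series is $$\delta(G)=\sum_{t,s\in T_A}\langle G,t\,.\,s\rangle\, t\otimes s\in(\Bbbk T_A\otimes\Bbbk T_A)^*,$$ i.e. the transpose of the product, and $(\Bbbk T_A)^*\otimes(\Bbbk T_A)^*$ is regarded as a subspace of $(\Bbbk T_A\otimes\Bbbk T_A)^*$ via $G_1\otimes G_2=\sum_{t,s}\langle G_1,t\rangle\langle G_2,s\rangle\, t\otimes s$. The restricted (Sweedler) dual $(\Bbbk T_A,\,.\,,\Delta)^\circ$ is the set of $G\in(\Bbbk T_A)^*$ such that $\delta(G)$ is a finite sum $\sum_{i=1}^rG_i\otimes H_i\in(\Bbbk T_A)^*\otimes(\Bbbk T_A)^*$; equivalently, the kernel of $G$ contains an ideal of $\Bbbk T_A$ of finite codimension. -}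

module Defs where

open import Algebra.Apartness.Bundles using (HeytingField; HeytingCommutativeRing)
open import Algebra.Bundles using (CommutativeRing)
open import Algebra.Module.Bundles using (LeftModule)
import Algebra.Module.Construct.TensorUnit as TensorUnit
open import Algebra.Module.Morphism.Structures using (module LeftModuleMorphisms)
import Algebra.Module.Properties.LeftModule as LeftModuleProperties
import Algebra.Definitions.RawMonoid as RawMonoidDefinitions
open import Data.Bool.Base using (if_then_else_)
open import Data.Fin.Base using (Fin)
open import Data.Fin.Properties using (inj⇒≟)
open import Data.List.Base using (List; []; _∷_; _++_; [_]; map; foldr; length; cartesianProductWith)
open import Data.Nat.Base using (ℕ; suc)
import Data.Nat.Properties as ℕ
open import Data.Product.Base using (Σ; ∃-syntax; _×_; _,_)
import Data.Vec.Functional as Vector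
open import Function.Bundles using (_↔_)
open import Function.Properties.Inverse using (Inverse⇒Injection)
open import Level using (Level; _⊔_)
open import Relation.Binary.Core using (Rel)
open import Relation.Binary.Definitions using (DecidableEquality)
open import Relation.Binary.PropositionalEquality.Core using (_≡_; refl)
open import Relation.Nullary.Decidable.Core using (yes; no; does)
open import Relation.Nullary.Negation.Core using (¬_)
open import Relation.Unary using (Pred; Decidable)
open import Relation.Unary.Properties using (U?)
import Relation.Binary.Reasoning.Setoid as ≈-Reasoning

private
  variable
    a c ℓ ℓ₁ ℓ₂ m n p q r x y ℓm ℓn ℓp : Level

fieldRing : HeytingField c ℓ₁ ℓ₂ → CommutativeRing c ℓ₁
fieldRing K = HeytingCommutativeRing.commutativeRing (HeytingField.heytingCommutativeRing K)

CharacteristicZero : HeytingField c ℓ₁ ℓ₂ → Set ℓ₁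
CharacteristicZero K = ∀ (k : ℕ) → ¬ (suc k · 1# ≈ 0#)
  where
  open CommutativeRing (fieldRing K) using (_≈_; 0#; 1#; +-rawMonoid)
  open RawMonoidDefinitions +-rawMonoid using () renaming (_×_ to infix 8 _·_)

IsFinite : Set a → Set a
IsFinite A = ∃[ k ] (A ↔ Fin k)

module Linear (R : CommutativeRing c ℓ) where

  open CommutativeRing R
    using (Carrier; _≈_; _+_; _*_; -_; 0#; 1#; ring)
  private module R = CommutativeRing R

  VectorSpace : ∀ m ℓm → Set _
  VectorSpace m ℓm = LeftModule ring m ℓm

  ∣_∣ : VectorSpace m ℓm → Set m
  ∣_∣ = LeftModule.Carrierᴹ

  Ground : VectorSpace c ℓ
  Ground = TensorUnit.leftModule {R = ring}

  infixr 1 _⊸_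

  record _⊸_ (M : VectorSpace m ℓm) (N : VectorSpace n ℓn)
             : Set (c ⊔ m ⊔ ℓm ⊔ n ⊔ ℓn) where
    open LeftModule M using () renaming (rawLeftModule to rawM)
    open LeftModule N using () renaming (rawLeftModule to rawN)
    field
      ⟦_⟧          : ∣ M ∣ → ∣ N ∣
      homomorphism : LeftModuleMorphisms.IsLeftModuleHomomorphism rawM rawN ⟦_⟧
    open LeftModuleMorphisms.IsLeftModuleHomomorphism homomorphism public
      using (⟦⟧-cong; +ᴹ-homo; *ₗ-homo; 0ᴹ-homo; -ᴹ-homo)

  open _⊸_ public using (⟦_⟧)

  module _ {M : VectorSpace m ℓm} {N : VectorSpace n ℓn} where
    private
      module M = LeftModule M
      module N = LeftModule N

    mkLinear : (f : ∣ M ∣ → ∣ N ∣) →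
               (∀ {u v} → u M.≈ᴹ v → f u N.≈ᴹ f v) →
               (∀ u v → f (u M.+ᴹ v) N.≈ᴹ f u N.+ᴹ f v) →
               (∀ k u → f (k M.*ₗ u) N.≈ᴹ k N.*ₗ f u) →
               M ⊸ N
    mkLinear f f-cong f-+ f-* = record
      { ⟦_⟧ = f
      ; homomorphism = record
        { +ᴹ-isGroupHomomorphism = record
          { isMonoidHomomorphism = record
            { isMagmaHomomorphism = record
              { isRelHomomorphism = record { cong = f-cong }
              ; homo = f-+
              }
            ; ε-homo = f-0
            }
          ; ⁻¹-homo = λ u → inverseˡ-uniqueᴹ _ _
              (N.≈ᴹ-trans (N.≈ᴹ-sym (f-+ _ _)) (N.≈ᴹ-trans (f-cong (M.-ᴹ‿inverseˡ u)) f-0))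
          }
        ; *ₗ-homo = f-*
        }
      }
      where
      open LeftModuleProperties N using (inverseˡ-uniqueᴹ)
      f-0 : f M.0ᴹ N.≈ᴹ N.0ᴹ
      f-0 = N.≈ᴹ-trans (f-cong (M.≈ᴹ-sym (M.*ₗ-zeroˡ M.0ᴹ)))
              (N.≈ᴹ-trans (f-* 0# M.0ᴹ) (N.*ₗ-zeroˡ _))

  _⊙_ : {M : VectorSpace m ℓm} {N : VectorSpace n ℓn} {P : VectorSpace p ℓp} →
        N ⊸ P → M ⊸ N → M ⊸ P
  _⊙_ {P = P} g f = mkLinear (λ u → g.⟦ f.⟦ u ⟧ ⟧)
    (λ e → g.⟦⟧-cong (f.⟦⟧-cong e))
    (λ u v → P.≈ᴹ-trans (g.⟦⟧-cong (f.+ᴹ-homo u v)) (g.+ᴹ-homo _ _))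
    (λ k u → P.≈ᴹ-trans (g.⟦⟧-cong (f.*ₗ-homo k u)) (g.*ₗ-homo k _))
    where
    module f = _⊸_ f
    module g = _⊸_ g
    module P = LeftModule P

  -- Without quotient types, a vector space given by generators and
  -- relations is the setoid of formal linear expressions under the
  -- least congruence containing the relations and the module axioms.

  infixl 6 _+ᵀ_
  infixr 7 _*ᵀ_

  data Term (X : Set x) : Set (c ⊔ x) where
    gen  : X → Term X
    0ᵀ   : Term X
    _+ᵀ_ : Term X → Term X → Term X
    _*ᵀ_ : Carrier → Term X → Term X

  module _ {X : Set x} (_∼_ : Rel (Term X) r) where

    infix 4 _≈ᵀ_

    data _≈ᵀ_ : Rel (Term X) (c ⊔ ℓ ⊔ x ⊔ r) where
      rel      : ∀ {u v} → u ∼ v → u ≈ᵀ v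
      reflᵀ    : ∀ {u} → u ≈ᵀ u
      symᵀ     : ∀ {u v} → u ≈ᵀ v → v ≈ᵀ u
      transᵀ   : ∀ {u v w} → u ≈ᵀ v → v ≈ᵀ w → u ≈ᵀ w
      +-congᵀ  : ∀ {u u′ v v′} → u ≈ᵀ u′ → v ≈ᵀ v′ → u +ᵀ v ≈ᵀ u′ +ᵀ v′
      +-assocᵀ : ∀ u v w → (u +ᵀ v) +ᵀ w ≈ᵀ u +ᵀ (v +ᵀ w)
      +-idˡᵀ   : ∀ u → 0ᵀ +ᵀ u ≈ᵀ u
      +-commᵀ  : ∀ u v → u +ᵀ v ≈ᵀ v +ᵀ u
      *-congᵀ  : ∀ {k k′ u u′} → k ≈ k′ → u ≈ᵀ u′ → k *ᵀ u ≈ᵀ k′ *ᵀ u′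
      *-zeroˡᵀ : ∀ u → 0# *ᵀ u ≈ᵀ 0ᵀ
      *-zeroʳᵀ : ∀ k → k *ᵀ 0ᵀ ≈ᵀ 0ᵀ
      distribʳᵀ : ∀ u k l → (k + l) *ᵀ u ≈ᵀ k *ᵀ u +ᵀ l *ᵀ u
      distribˡᵀ : ∀ k u v → k *ᵀ (u +ᵀ v) ≈ᵀ k *ᵀ u +ᵀ k *ᵀ v
      *-idˡᵀ   : ∀ u → 1# *ᵀ u ≈ᵀ u
      *-assocᵀ : ∀ k l u → (k * l) *ᵀ u ≈ᵀ k *ᵀ (l *ᵀ u)

    Presented : VectorSpace (c ⊔ x) (c ⊔ ℓ ⊔ x ⊔ r)
    Presented = record
      { Carrierᴹ = Term X
      ; _≈ᴹ_ = _≈ᵀ_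
      ; _+ᴹ_ = _+ᵀ_
      ; _*ₗ_ = _*ᵀ_
      ; 0ᴹ = 0ᵀ
      ; -ᴹ_ = (- 1#) *ᵀ_
      ; isLeftModule = record
        { isLeftSemimodule = record
          { +ᴹ-isCommutativeMonoid = record
            { isMonoid = record
              { isSemigroup = record
                { isMagma = record
                  { isEquivalence = record { refl = reflᵀ ; sym = symᵀ ; trans = transᵀ }
                  ; ∙-cong = +-congᵀ
                  }
                ; assoc = +-assocᵀ
                }
              ; identity = +-idˡᵀ , λ u → transᵀ (+-commᵀ u 0ᵀ) (+-idˡᵀ u)
              }
            ; comm = +-commᵀ
            }
          ; isPreleftSemimodule = record
            { *ₗ-cong = *-congᵀ
            ; *ₗ-zeroˡ = *-zeroˡᵀ
            ; *ₗ-distribʳ = distribʳᵀ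
            ; *ₗ-identityˡ = *-idˡᵀ
            ; *ₗ-assoc = *-assocᵀ
            ; *ₗ-zeroʳ = *-zeroʳᵀ
            ; *ₗ-distribˡ = distribˡᵀ
            }
          }
        ; -ᴹ‿cong = *-congᵀ R.refl
        ; -ᴹ‿inverse = inverseˡ , λ u → transᵀ (+-commᵀ u _) (inverseˡ u)
        }
      }
      where
      inverseˡ : ∀ u → ((- 1#) *ᵀ u) +ᵀ u ≈ᵀ 0ᵀ
      inverseˡ u =
        transᵀ (+-congᵀ reflᵀ (symᵀ (*-idˡᵀ u)))
          (transᵀ (symᵀ (distribʳᵀ u (- 1#) 1#))
            (transᵀ (*-congᵀ (R.-‿inverseˡ 1#) reflᵀ) (*-zeroˡᵀ u)))

  module _ {X : Set x} (P : VectorSpace p ℓp) where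
    private module P = LeftModule P

    evaluate : (X → ∣ P ∣) → Term X → ∣ P ∣
    evaluate f (gen z)  = f z
    evaluate f 0ᵀ       = P.0ᴹ
    evaluate f (u +ᵀ v) = evaluate f u P.+ᴹ evaluate f v
    evaluate f (k *ᵀ u) = k P.*ₗ evaluate f u

    module _ {_∼_ : Rel (Term X) r} (f : X → ∣ P ∣)
             (f-rel : ∀ {u v} → u ∼ v → evaluate f u P.≈ᴹ evaluate f v) where

      evaluate-cong : ∀ {u v} → _≈ᵀ_ _∼_ u v → evaluate f u P.≈ᴹ evaluate f v
      evaluate-cong (rel e)            = f-rel e
      evaluate-cong reflᵀ              = P.≈ᴹ-refl
      evaluate-cong (symᵀ e)           = P.≈ᴹ-sym (evaluate-cong e)
      evaluate-cong (transᵀ d e)       = P.≈ᴹ-trans (evaluate-cong d) (evaluate-cong e)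
      evaluate-cong (+-congᵀ d e)      = P.+ᴹ-cong (evaluate-cong d) (evaluate-cong e)
      evaluate-cong (+-assocᵀ u v w)   = P.+ᴹ-assoc _ _ _
      evaluate-cong (+-idˡᵀ u)         = P.+ᴹ-identityˡ _
      evaluate-cong (+-commᵀ u v)      = P.+ᴹ-comm _ _
      evaluate-cong (*-congᵀ d e)      = P.*ₗ-cong d (evaluate-cong e)
      evaluate-cong (*-zeroˡᵀ u)       = P.*ₗ-zeroˡ _
      evaluate-cong (*-zeroʳᵀ k)       = P.*ₗ-zeroʳ _
      evaluate-cong (distribʳᵀ u k l)  = P.*ₗ-distribʳ _ _ _
      evaluate-cong (distribˡᵀ k u v)  = P.*ₗ-distribˡ _ _ _
      evaluate-cong (*-idˡᵀ u)         = P.*ₗ-identityˡ _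
      evaluate-cong (*-assocᵀ k l u)   = P.*ₗ-assoc _ _ _

      induced : Presented _∼_ ⊸ P
      induced = mkLinear (evaluate f) evaluate-cong
        (λ _ _ → P.≈ᴹ-refl) (λ _ _ → P.≈ᴹ-refl)

  data NoRelation {X : Set x} : Rel (Term X) (c ⊔ x) where

  Free : Set x → VectorSpace (c ⊔ x) (c ⊔ ℓ ⊔ x)
  Free X = Presented (NoRelation {X = X})

  linearExtension : {X : Set x} (P : VectorSpace p ℓp) → (X → ∣ P ∣) → Free X ⊸ P
  linearExtension P f = induced P f λ ()

  module _ (M : VectorSpace m ℓm) (N : VectorSpace n ℓn) where
    private
      module M = LeftModule M
      module N = LeftModule N

    data Bilinearity : Rel (Term (∣ M ∣ × ∣ N ∣)) (c ⊔ m ⊔ n ⊔ ℓm ⊔ ℓn) where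
      congruent : ∀ {u u′ v v′} → u M.≈ᴹ u′ → v N.≈ᴹ v′ →
                  Bilinearity (gen (u , v)) (gen (u′ , v′))
      +ˡ : ∀ u u′ v → Bilinearity (gen (u M.+ᴹ u′ , v)) (gen (u , v) +ᵀ gen (u′ , v))
      +ʳ : ∀ u v v′ → Bilinearity (gen (u , v N.+ᴹ v′)) (gen (u , v) +ᵀ gen (u , v′))
      *ˡ : ∀ k u v → Bilinearity (gen (k M.*ₗ u , v)) (k *ᵀ gen (u , v))
      *ʳ : ∀ k u v → Bilinearity (gen (u , k N.*ₗ v)) (k *ᵀ gen (u , v))

    infixr 7 _⊗_

    _⊗_ : VectorSpace (c ⊔ m ⊔ n) (c ⊔ ℓ ⊔ m ⊔ n ⊔ ℓm ⊔ ℓn)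
    _⊗_ = Presented Bilinearity

  module _ {M : VectorSpace m ℓm} {N : VectorSpace n ℓn} (P : VectorSpace p ℓp) where
    private
      module M = LeftModule M
      module N = LeftModule N
      module P = LeftModule P

    bilinearMap : (f : ∣ M ∣ → ∣ N ∣ → ∣ P ∣) →
                  (∀ {u u′ v v′} → u M.≈ᴹ u′ → v N.≈ᴹ v′ → f u v P.≈ᴹ f u′ v′) →
                  (∀ u u′ v → f (u M.+ᴹ u′) v P.≈ᴹ f u v P.+ᴹ f u′ v) →
                  (∀ u v v′ → f u (v N.+ᴹ v′) P.≈ᴹ f u v P.+ᴹ f u v′) →
                  (∀ k u v → f (k M.*ₗ u) v P.≈ᴹ k P.*ₗ f u v) →
                  (∀ k u v → f u (k N.*ₗ v) P.≈ᴹ k P.*ₗ f u v) →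
                  M ⊗ N ⊸ P
    bilinearMap f f-cong f-+ˡ f-+ʳ f-*ˡ f-*ʳ = induced P (λ (u , v) → f u v) λ where
      (congruent d e) → f-cong d e
      (+ˡ u u′ v)     → f-+ˡ u u′ v
      (+ʳ u v v′)     → f-+ʳ u v v′
      (*ˡ k u v)      → f-*ˡ k u v
      (*ʳ k u v)      → f-*ʳ k u v

  module _ {X : Set x} {Y : Set y} (P : VectorSpace p ℓp) (f : X → Y → ∣ P ∣) where
    private
      module P = LeftModule P

      f̂ : Term X → Term Y → ∣ P ∣
      f̂ u v = evaluate P (λ s → evaluate P (f s) v) u

      f̂-congʳ : ∀ u {v v′} → _≈ᵀ_ NoRelation v v′ → f̂ u v P.≈ᴹ f̂ u v′
      f̂-congʳ (gen s)  e = evaluate-cong P (f s) (λ ()) e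
      f̂-congʳ 0ᵀ       e = P.≈ᴹ-refl
      f̂-congʳ (u +ᵀ w) e = P.+ᴹ-cong (f̂-congʳ u e) (f̂-congʳ w e)
      f̂-congʳ (k *ᵀ u) e = P.*ₗ-cong R.refl (f̂-congʳ u e)

      f̂-+ʳ : ∀ u v v′ → f̂ u (v +ᵀ v′) P.≈ᴹ f̂ u v P.+ᴹ f̂ u v′
      f̂-+ʳ (gen s)  v v′ = P.≈ᴹ-refl
      f̂-+ʳ 0ᵀ       v v′ = P.≈ᴹ-sym (P.+ᴹ-identityˡ _)
      f̂-+ʳ (u +ᵀ w) v v′ = begin
        f̂ u (v +ᵀ v′) P.+ᴹ f̂ w (v +ᵀ v′)
          ≈⟨ P.+ᴹ-cong (f̂-+ʳ u v v′) (f̂-+ʳ w v v′) ⟩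
        (f̂ u v P.+ᴹ f̂ u v′) P.+ᴹ (f̂ w v P.+ᴹ f̂ w v′)
          ≈⟨ P.+ᴹ-assoc _ _ _ ⟩
        f̂ u v P.+ᴹ (f̂ u v′ P.+ᴹ (f̂ w v P.+ᴹ f̂ w v′))
          ≈⟨ P.+ᴹ-congˡ (P.+ᴹ-assoc _ _ _) ⟨
        f̂ u v P.+ᴹ ((f̂ u v′ P.+ᴹ f̂ w v) P.+ᴹ f̂ w v′)
          ≈⟨ P.+ᴹ-congˡ (P.+ᴹ-congʳ (P.+ᴹ-comm _ _)) ⟩
        f̂ u v P.+ᴹ ((f̂ w v P.+ᴹ f̂ u v′) P.+ᴹ f̂ w v′)
          ≈⟨ P.+ᴹ-congˡ (P.+ᴹ-assoc _ _ _) ⟩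
        f̂ u v P.+ᴹ (f̂ w v P.+ᴹ (f̂ u v′ P.+ᴹ f̂ w v′))
          ≈⟨ P.+ᴹ-assoc _ _ _ ⟨
        (f̂ u v P.+ᴹ f̂ w v) P.+ᴹ (f̂ u v′ P.+ᴹ f̂ w v′) ∎
        where open ≈-Reasoning P.≈ᴹ-setoid
      f̂-+ʳ (k *ᵀ u) v v′ =
        P.≈ᴹ-trans (P.*ₗ-cong R.refl (f̂-+ʳ u v v′)) (P.*ₗ-distribˡ k _ _)

      f̂-*ʳ : ∀ k u v → f̂ u (k *ᵀ v) P.≈ᴹ k P.*ₗ f̂ u v
      f̂-*ʳ k (gen s)  v = P.≈ᴹ-refl
      f̂-*ʳ k 0ᵀ       v = P.≈ᴹ-sym (P.*ₗ-zeroʳ k)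
      f̂-*ʳ k (u +ᵀ w) v = P.≈ᴹ-trans (P.+ᴹ-cong (f̂-*ʳ k u v) (f̂-*ʳ k w v))
                            (P.≈ᴹ-sym (P.*ₗ-distribˡ k _ _))
      f̂-*ʳ k (l *ᵀ u) v = begin
        l P.*ₗ f̂ u (k *ᵀ v)       ≈⟨ P.*ₗ-cong R.refl (f̂-*ʳ k u v) ⟩
        l P.*ₗ (k P.*ₗ f̂ u v)     ≈⟨ P.*ₗ-assoc l k _ ⟨
        (l * k) P.*ₗ f̂ u v        ≈⟨ P.*ₗ-cong (R.*-comm l k) P.≈ᴹ-refl ⟩
        (k * l) P.*ₗ f̂ u v        ≈⟨ P.*ₗ-assoc k l _ ⟩
        k P.*ₗ (l P.*ₗ f̂ u v)     ∎
        where open ≈-Reasoning P.≈ᴹ-setoid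

    bilinearExtension : Free X ⊗ Free Y ⊸ P
    bilinearExtension = bilinearMap P f̂
      (λ {u} {u′} {v} {v′} d e → P.≈ᴹ-trans
        (evaluate-cong P (λ s → evaluate P (f s) v) (λ ()) d) (f̂-congʳ u′ e))
      (λ _ _ _ → P.≈ᴹ-refl)
      f̂-+ʳ
      (λ _ _ _ → P.≈ᴹ-refl)
      f̂-*ʳ

  Dual : VectorSpace m ℓm → Set (c ⊔ ℓ ⊔ m ⊔ ℓm)
  Dual M = M ⊸ Ground

  module _ {M : VectorSpace m ℓm} where
    private module M = LeftModule M

    infix 4 _≋_
    _≋_ : Rel (Dual M) (ℓ ⊔ m)
    G ≋ H = ∀ u → ⟦ G ⟧ u ≈ ⟦ H ⟧ u

    0* : Dual M
    0* = mkLinear (λ _ → 0#) (λ _ → R.refl)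
      (λ _ _ → R.sym (R.+-identityˡ 0#)) (λ k _ → R.sym (R.zeroʳ k))

    infixl 6 _⊞_
    _⊞_ : Dual M → Dual M → Dual M
    G ⊞ H = mkLinear (λ u → ⟦ G ⟧ u + ⟦ H ⟧ u)
      (λ e → R.+-cong (G.⟦⟧-cong e) (H.⟦⟧-cong e))
      (λ u v → R.trans (R.+-cong (G.+ᴹ-homo u v) (H.+ᴹ-homo u v))
        (interchange _ _ _ _))
      (λ k u → R.trans (R.+-cong (G.*ₗ-homo k u) (H.*ₗ-homo k u))
        (R.sym (R.distribˡ k _ _)))
      where
      module G = _⊸_ G
      module H = _⊸_ H
      open import Algebra.Properties.CommutativeSemigroup R.+-commutativeSemigroup
        using (interchange)

    ∑ : ∀ {k} → (Fin k → Dual M) → Dual M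
    ∑ = Vector.foldr _⊞_ 0*

  infixr 7 _⊠_

  -- G₁ ⊗ G₂, already viewed inside the dual of M ⊗ N.
  _⊠_ : {M : VectorSpace m ℓm} {N : VectorSpace n ℓn} →
        Dual M → Dual N → Dual (M ⊗ N)
  G ⊠ H = bilinearMap Ground (λ u v → ⟦ G ⟧ u * ⟦ H ⟧ v)
    (λ d e → R.*-cong (G.⟦⟧-cong d) (H.⟦⟧-cong e))
    (λ u u′ v → R.trans (R.*-congʳ (G.+ᴹ-homo u u′)) (R.distribʳ _ _ _))
    (λ u v v′ → R.trans (R.*-congˡ (H.+ᴹ-homo v v′)) (R.distribˡ _ _ _))
    (λ k u v → R.trans (R.*-congʳ (G.*ₗ-homo k u)) (R.*-assoc _ _ _))
    (λ k u v → R.trans (R.*-congˡ (H.*ₗ-homo k v)) (x∙yz≈y∙xz _ _ _))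
    where
    module G = _⊸_ G
    module H = _⊸_ H
    open import Algebra.Properties.CommutativeSemigroup R.*-commutativeSemigroup
      using (x∙yz≈y∙xz)

  -- Only the operations of a Hopf algebra: the restricted dual is
  -- determined by the product, and no Hopf algebra law enters into it.
  record HopfOperations (M : VectorSpace m ℓm) : Set (c ⊔ ℓ ⊔ m ⊔ ℓm) where
    field
      product   : M ⊗ M ⊸ M
      unit      : ∣ M ∣
      coproduct : M ⊸ M ⊗ M
      counit    : Dual M

  module _ {M : VectorSpace m ℓm} (𝓗 : HopfOperations M) where
    open HopfOperations 𝓗

    transpose : Dual M → Dual (M ⊗ M)
    transpose G = G ⊙ product

    RestrictedDual : Pred (Dual M) (c ⊔ ℓ ⊔ m ⊔ ℓm)
    RestrictedDual G =
      Σ ℕ λ k → Σ (Fin k → Dual M) λ G′ → Σ (Fin k → Dual M) λ G″ →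
        transpose G ≋ ∑ (λ i → G′ i ⊠ G″ i)

-- A vertex is the list of its branches, each with the colour of the
-- edge leading to it.
data Tree (A : Set a) : Set a where
  node : List (A × Tree A) → Tree A

module _ {A : Set a} where

  branches : Tree A → List (A × Tree A)
  branches (node bs) = bs

  • : Tree A
  • = node []

  infixr 6 _∙_
  _∙_ : Tree A → Tree A → Tree A
  t ∙ s = node (branches t ++ branches s)

  Planted : Pred (Tree A) _
  Planted t = length (branches t) ≡ 1

  planted? : Decidable Planted
  planted? t = length (branches t) ℕ.≟ 1

  -- Pairs (t_c , t_s), one for each subtree t_s containing the root.  A
  -- branch is either pruned whole, or its edge is kept and its own
  -- subtree pruned; concatenating in order gives depth-first order.
  mutual
    prunings : Tree A → List (Tree A × Tree A)
    prunings (node bs) = map (λ (cs , ss) → node cs , node ss) (forestPrunings bs)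

    forestPrunings : List (A × Tree A) → List (List (A × Tree A) × List (A × Tree A))
    forestPrunings []             = [ [] , [] ]
    forestPrunings ((α , t) ∷ bs) =
      cartesianProductWith (λ (cs , ss) (cs′ , ss′) → cs ++ cs′ , ss ++ ss′)
        (([ α , t ] , []) ∷ map (λ (u , s) → branches u , [ α , s ]) (prunings t))
        (forestPrunings bs)

  module _ (_≟_ : DecidableEquality A) where
    mutual
      treeEq : DecidableEquality (Tree A)
      treeEq (node bs) (node cs) with forestEq bs cs
      ... | yes refl = yes refl
      ... | no  bs≢cs = no λ { refl → bs≢cs refl }

      forestEq : DecidableEquality (List (A × Tree A))
      forestEq []             []             = yes refl
      forestEq []             (_ ∷ _)        = no λ ()
      forestEq (_ ∷ _)        []             = no λ ()
      forestEq ((α , t) ∷ bs) ((β , s) ∷ cs) with α ≟ β | treeEq t s | forestEq bs cs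
      ... | yes refl | yes refl | yes refl = yes refl
      ... | no  α≢β  | _        | _        = no λ { refl → α≢β refl }
      ... | yes _    | no  t≢s  | _        = no λ { refl → t≢s refl }
      ... | yes _    | yes _    | no bs≢cs = no λ { refl → bs≢cs refl }

module Series (K : HeytingField c ℓ₁ ℓ₂) (A : Set a) (A-finite : IsFinite A) where

  open CommutativeRing (fieldRing K) public using (_≈_; 0#; 1#)
  open Linear (fieldRing K) public

  _≟ᵗ_ : DecidableEquality (Tree A)
  _≟ᵗ_ = let (_ , A↔Fin) = A-finite in treeEq (inj⇒≟ (Inverse⇒Injection A↔Fin))

  𝕜T : VectorSpace (c ⊔ a) (c ⊔ ℓ₁ ⊔ a)
  𝕜T = Free (Tree A)

  FormalSeries : Set (c ⊔ ℓ₁ ⊔ a)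
  FormalSeries = Dual 𝕜T

  ⟨_,_⟩ : FormalSeries → Tree A → HeytingField.Carrier K
  ⟨ G , t ⟩ = ⟦ G ⟧ (gen t)

  characteristic : {P : Pred (Tree A) p} → Decidable P → FormalSeries
  characteristic P? = linearExtension Ground (λ t → if does (P? t) then 1# else 0#)

  dual : Tree A → FormalSeries
  dual t = characteristic (_≟ᵗ t)

  -- The counit is 1 at • and 0 at every other tree, that is, the
  -- functional dual to •.
  𝕜T-operations : HopfOperations 𝕜T
  𝕜T-operations = record
    { product   = bilinearExtension 𝕜T (λ t s → gen (t ∙ s))
    ; unit      = gen •
    ; coproduct = linearExtension (𝕜T ⊗ 𝕜T)
        (λ t → foldr (λ (tᶜ , tˢ) u → gen (gen tᶜ , gen tˢ) +ᵀ u) 0ᵀ (prunings t))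
    ; counit    = dual •
    }

  δ : FormalSeries → Dual (𝕜T ⊗ 𝕜T)
  δ = transpose 𝕜T-operations

  F : FormalSeries
  F = characteristic planted?

  F* : FormalSeries
  F* = characteristic U?

{-# OPTIONS --safe #-}
-- A linear functional on 𝕜T ⊗ 𝕜T is determined by its values on the tensors
-- t ⊗ s of two trees.  On these, the formula for F says that t ∙ s has exactly
-- one branch iff one of t, s is trivial and the other is planted, and the
-- formula for F* says that 1 = 1 · 1.
module Submission where

open import Defs
open import Algebra.Apartness.Bundles using (HeytingField)
open import Algebra.Bundles using (CommutativeRing)
open import Algebra.Module.Bundles using (LeftModule)
open import Data.Fin.Patterns using (0F; 1F)
open import Data.List.Base using ([]; _∷_)
open import Data.Product using (_×_; _,_)
open import Level using (Level)
open import Relation.Binary.Core using (Rel)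
open import Relation.Unary using (_∈_)

private
  variable
    a c ℓ ℓ₁ ℓ₂ m n p r x y ℓm ℓn ℓp : Level

module _ (R : CommutativeRing c ℓ) where
  open Linear R
  private module R = CommutativeRing R

  module _ {P : VectorSpace p ℓp} where
    private module P = LeftModule P

    -- An element is itself a formal linear expression in the generators, so linearity of both maps
    -- propagates the agreement by induction on that expression.
    presented-ext : {X : Set x} {_∼_ : Rel (Term X) r} (Φ Ψ : Presented _∼_ ⊸ P) →
                    (∀ z → ⟦ Φ ⟧ (gen z) P.≈ᴹ ⟦ Ψ ⟧ (gen z)) →
                    ∀ u → ⟦ Φ ⟧ u P.≈ᴹ ⟦ Ψ ⟧ u
    presented-ext {_∼_ = _∼_} Φ Ψ agree = go
      where
      module Φ = _⊸_ Φ
      module Ψ = _⊸_ Ψ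
      go : ∀ u → Φ.⟦ u ⟧ P.≈ᴹ Ψ.⟦ u ⟧
      go (gen z)  = agree z
      go 0ᵀ       = P.≈ᴹ-trans Φ.0ᴹ-homo (P.≈ᴹ-sym Ψ.0ᴹ-homo)
      go (u +ᵀ v) = P.≈ᴹ-trans (Φ.+ᴹ-homo u v)
                      (P.≈ᴹ-trans (P.+ᴹ-cong (go u) (go v)) (P.≈ᴹ-sym (Ψ.+ᴹ-homo u v)))
      go (k *ᵀ u) = P.≈ᴹ-trans (Φ.*ₗ-homo k u)
                      (P.≈ᴹ-trans (P.*ₗ-cong R.refl (go u)) (P.≈ᴹ-sym (Ψ.*ₗ-homo k u)))

  module _ {M : VectorSpace m ℓm} {N : VectorSpace n ℓn} where
    private
      module M = LeftModule M
      module N = LeftModule N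

    -- Fixing one factor of a pure tensor leaves a map that is linear by the defining relations of
    -- the tensor product; composing with it restricts a map on `M ⊗ N` to a single factor.
    -⊗_ : ∣ N ∣ → M ⊸ M ⊗ N
    -⊗ v = mkLinear (λ u → gen (u , v)) (λ d → rel (congruent d N.≈ᴹ-refl))
      (λ u u′ → rel (+ˡ u u′ v)) (λ k u → rel (*ˡ k u v))

    _⊗- : ∣ M ∣ → N ⊸ M ⊗ N
    u ⊗- = mkLinear (λ v → gen (u , v)) (λ e → rel (congruent M.≈ᴹ-refl e))
      (λ v v′ → rel (+ʳ u v v′)) (λ k v → rel (*ʳ k u v))

  module _ {X : Set x} {Y : Set y} {P : VectorSpace p ℓp} where
    private module P = LeftModule P

    -- The generators of the tensor product are pairs of arbitrary vectors, so extensionality is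
    -- applied three times: to reach pure tensors, then to reduce the left factor to a basis
    -- element, then the right one.
    ⊗-ext : (Φ Ψ : Free X ⊗ Free Y ⊸ P) →
            (∀ t s → ⟦ Φ ⟧ (gen (gen t , gen s)) P.≈ᴹ ⟦ Ψ ⟧ (gen (gen t , gen s))) →
            ∀ u → ⟦ Φ ⟧ u P.≈ᴹ ⟦ Ψ ⟧ u
    ⊗-ext Φ Ψ agree = presented-ext {P = P} Φ Ψ λ (u , v) →
      presented-ext {P = P} (_⊙_ {P = P} Φ (-⊗ v)) (_⊙_ {P = P} Ψ (-⊗ v)) (λ t →
        presented-ext {P = P} (_⊙_ {P = P} Φ (gen t ⊗-)) (_⊙_ {P = P} Ψ (gen t ⊗-)) (agree t) v) u

module _ (K : HeytingField c ℓ₁ ℓ₂) (A : Set a) (A-finite : IsFinite A) where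
  open Series K A A-finite
  open CommutativeRing (fieldRing K)
    using (_+_; _*_; sym; trans; +-cong; +-congˡ; +-identityˡ; +-identityʳ; *-identityˡ; *-identityʳ; zeroˡ; zeroʳ)

  F-primitive : δ F ≋ dual • ⊠ F ⊞ F ⊠ dual •
  F-primitive = ⊗-ext (fieldRing K) {P = Ground} (δ F) (dual • ⊠ F ⊞ F ⊠ dual •)
    λ t s → sym (onTrees t s)
    where
    onTrees : ∀ t s → ⟨ dual • , t ⟩ * ⟨ F , s ⟩ + ⟨ F , t ⟩ * ⟨ dual • , s ⟩ ≈ ⟨ F , t ∙ s ⟩
    -- Here `• ∙ s` reduces to `s`, and the second summand vanishes because `•` is not planted.
    onTrees (node [])          (node _)       =
      trans (+-cong (*-identityˡ _) (zeroˡ _)) (+-identityʳ _)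
    onTrees (node (_ ∷ []))    (node [])      =
      trans (+-cong (zeroˡ _) (*-identityˡ _)) (+-identityˡ _)
    -- The product has at least two branches, and each summand contains the coefficient of `dual •`
    -- at a non-trivial tree.
    onTrees (node (_ ∷ []))    (node (_ ∷ _)) =
      trans (+-cong (zeroˡ _) (zeroʳ _)) (+-identityˡ _)
    onTrees (node (_ ∷ _ ∷ _)) (node _)       =
      trans (+-cong (zeroˡ _) (zeroˡ _)) (+-identityˡ _)

  F*-groupLike : δ F* ≋ F* ⊠ F*
  F*-groupLike = ⊗-ext (fieldRing K) {P = Ground} (δ F*) (F* ⊠ F*)
    λ _ _ → sym (*-identityʳ 1#)

  F-restricted : F ∈ RestrictedDual 𝕜T-operations
  F-restricted = 2 , (λ { 0F → dual • ; 1F → F }) , (λ { 0F → F ; 1F → dual • }) ,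
    -- The fold `∑` ends in `0*`, so the last summand carries a trailing zero.
    λ u → trans (F-primitive u) (+-congˡ (sym (+-identityʳ _)))

  F*-restricted : F* ∈ RestrictedDual 𝕜T-operations
  F*-restricted = 1 , (λ _ → F*) , (λ _ → F*) ,
    λ u → trans (F*-groupLike u) (sym (+-identityʳ _))

proposition6p1 : ∀ {c ℓ₁ ℓ₂ a} (K : HeytingField c ℓ₁ ℓ₂) → CharacteristicZero K →
    (A : Set a) (A-finite : IsFinite A) →
    let open Series K A A-finite in
    F ∈ RestrictedDual 𝕜T-operations ×
    F* ∈ RestrictedDual 𝕜T-operations ×
    δ F ≋ dual • ⊠ F ⊞ F ⊠ dual • ×
    (⟨ F* , • ⟩ ≈ 1#) × (δ F* ≋ F* ⊠ F*)
proposition6p1 K _ A A-finite =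
  F-restricted K A A-finite ,
  F*-restricted K A A-finite ,
  F-primitive K A A-finite ,
  -- This normalisation, true by computation, excludes the zero series, which also equals its own
  -- tensor square under `δ`.
  CommutativeRing.refl (fieldRing K) ,
  F*-groupLike K A A-finite
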